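{- Let $r\equiv1\pmod4$ with $r\ge9$, and let $H$ be an $ABAB$ starter in $\mathcal C_4(r)$, arising from a normalized directed $R^*$-terrace of $\mathbb Z_r$. Then the path $0\to2\to4\to\cdots\to2r$ in $\mathcal C_4(r)$ is rainbow for the development colouring of $H$, i.e. its $r$ arcs belong to $r$ pairwise distinct cycles among $H_k=H+4k$, $k\in\mathbb Z_r$. Hence $H$ is chain-compatible.
   Context: Let $[r]=\{1,\ldots,r\}$; for nonzero $x\in\mathbb Z_r$, $[x]_r\in\{1,\ldots,r-1\}$ is its representative. $\mathcal C_4(r)$ is the directed Cayley digraph on $\mathbb Z_{4r}$ with arcs $x\to x+s$, $s\in[r]$ (tail $x$, step $s$). A $4$-layer balanced Hamilton starter is a directed Hamilton cycle containing, for each $(j,s)\in\mathbb Z_4\times[r]$, exactly one arc of step $s$ with tail congruent to $j$ mod $4$. A directed rotational terrace of $\mathbb Z_r$ is a cyclic ordering $(P_0,\ldots,P_{r-2})$ of $\mathbb Z_r\setminus\{0\}$ whose cyclic differences $d_i=[P_{i+1}-P_i]_r$ ($i\in\mathbb Z_{r-1}$) run through $1,\ldots,r-1$ exactly once. It is a normalized directed $R^*$-terrace if $P_1=P_0+P_2$ in $\mathbb Z_r$ and both integers $a:=d_0$ and $b:=d_1$ are odd. Write its difference word as $(d_0,\ldots,d_{r-2})=(a,b,D')$. Put $A=(a,r,b,D')$ and $B=(b,r,a,D')$ (both permutations of $[r]$). The $ABAB$ starter $H$ is the closed walk in $\mathcal C_4(r)$ starting at $0$ whose successive steps are the letters of the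 concatenated word $ABAB$; it is a $4$-layer balanced Hamilton starter (a fact established in the paper). The translates $H_k=H+4k$ ($k\in\mathbb Z_r$) partition the arcs of $\mathcal C_4(r)$; the development colour of an arc is the unique $k$ with the arc in $H_k$. $H$ is chain-compatible if one arc can be selected from each $H_k$ ($k\in\mathbb Z_r$) so that the selected $r$ arcs form a simple directed path (with $r+1$ pairwise distinct vertices). -}

module Defs where

open import Data.Fin.Base using (Fin; toℕ; inject₁) renaming (suc to fsuc)
open import Data.Fin.Permutation using (Permutation′; _⟨$⟩ʳ_)
open import Data.Fin.Properties using (nonZeroIndex)
open import Data.List.Base using (List; []; _∷_; _++_; map; drop; tabulate)
open import Data.List.Membership.Propositional using (_∈_)
open import Data.Nat.Base
  using (ℕ; suc; _+_; _*_; _∸_; _≤_; NonZero; NonTrivial; >-nonZero; nonTrivial⇒nonZero; nonTrivial⇒n>1)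
open import Data.Nat.DivMod using (_%_; _mod_)
open import Data.Nat.Properties using (m<n⇒0<n∸m; m*n≢0)
open import Data.Product.Base using (Σ-syntax; ∃-syntax; _×_; _,_)
open import Data.Product using (∃!)
open import Function.Definitions using (Injective)
open import Relation.Binary.PropositionalEquality using (_≡_; _≢_)

-- ℤ_n is represented by Fin n, a class being its least nonnegative residue.

infixl 6 _⊕_

_⊕_ : ∀ {n} → Fin n → ℕ → Fin n
_⊕_ {n} x m = ((toℕ x + m) mod n) {{nonZeroIndex x}}

-- The representative [x - y]_r in {0,…,r-1}; it is nonzero when x ≢ y.
diff : ∀ {r} → Fin r → Fin r → ℕ
diff {r} x y = ((toℕ x + (r ∸ toℕ y)) % r) {{nonZeroIndex x}}

module _ (r : ℕ) .{{r>1 : NonTrivial r}} where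

  private instance
    r≢0 : NonZero r
    r≢0 = nonTrivial⇒nonZero r

    r∸1≢0 : NonZero (r ∸ 1)
    r∸1≢0 = >-nonZero (m<n⇒0<n∸m (nonTrivial⇒n>1 r))

    4r≢0 : NonZero (4 * r)
    4r≢0 = m*n≢0 4 r

  -- Positions of a cyclic ordering are indexed by ℤ_{r-1}.
  position : ℕ → Fin (r ∸ 1)
  position k = k mod (r ∸ 1)

  differences : (Fin (r ∸ 1) → Fin r) → Fin (r ∸ 1) → ℕ
  differences P i = diff (P (i ⊕ 1)) (P i)

  record DirectedRotationalTerrace : Set where
    field
      P          : Fin (r ∸ 1) → Fin r
      P-nonzero  : ∀ i → toℕ (P i) ≢ 0
      P-once     : ∀ x → toℕ x ≢ 0 → ∃! _≡_ λ i → P i ≡ x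
      diffs-once : ∀ s → 1 ≤ s → s ≤ r ∸ 1 → ∃! _≡_ λ i → differences P i ≡ s

    d : Fin (r ∸ 1) → ℕ
    d = differences P

  record NormalizedR*Terrace : Set where
    field
      terrace : DirectedRotationalTerrace

    open DirectedRotationalTerrace terrace public

    a : ℕ
    a = d (position 0)

    b : ℕ
    b = d (position 1)

    field
      R*    : P (position 1) ≡ P (position 0) ⊕ toℕ (P (position 2))
      a-odd : a % 2 ≡ 1
      b-odd : b % 2 ≡ 1

    D′ A B ABAB : List ℕ
    D′   = drop 2 (tabulate d)
    A    = a ∷ r ∷ b ∷ D′
    B    = b ∷ r ∷ a ∷ D′
    ABAB = A ++ B ++ A ++ B

  Vertex : Set
  Vertex = Fin (4 * r)

  vertex : ℕ → Vertex
  vertex m = m mod (4 * r)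

  -- (x , s) stands for x → x + s; it is an arc of 𝒞₄(r) when IsArc holds.
  Arc : Set
  Arc = Vertex × ℕ

  tail head : Arc → Vertex
  tail (x , s) = x
  head (x , s) = x ⊕ s

  IsArc : Arc → Set
  IsArc (x , s) = 1 ≤ s × s ≤ r

  walk : Vertex → List ℕ → List Arc
  walk x []      = []
  walk x (s ∷ w) = (x , s) ∷ walk (x ⊕ s) w

  starter : NormalizedR*Terrace → List Arc
  starter T = walk (vertex 0) (NormalizedR*Terrace.ABAB T)

  translate : ℕ → Arc → Arc
  translate m (x , s) = (x ⊕ m , s)

  -- H_k = H + 4k
  develop : List Arc → Fin r → List Arc
  develop H k = map (translate (4 * toℕ k)) H

  HasColour : List Arc → Arc → Fin r → Set
  HasColour H e k = e ∈ develop H k × (∀ l → e ∈ develop H l → l ≡ k)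

  record IsSimplePath {n} (v : Fin (suc n) → Vertex) (e : Fin n → Arc) : Set where
    field
      distinct : Injective _≡_ _≡_ v
      arcs     : ∀ i → IsArc (e i)
      tails    : ∀ i → tail (e i) ≡ v (inject₁ i)
      heads    : ∀ i → head (e i) ≡ v (fsuc i)

  Rainbow : List Arc → ∀ {n} → (Fin n → Arc) → Set
  Rainbow H {n} e =
    Σ[ c ∈ (Fin n → Fin r) ] (∀ i → HasColour H (e i) (c i)) × Injective _≡_ _≡_ c

  -- The permutation is the order in which the path traverses the selected arcs.
  ChainCompatible : List Arc → Set
  ChainCompatible H =
    Σ[ e ∈ (Fin r → Arc) ] (∀ k → e k ∈ develop H k) ×
    (Σ[ π ∈ Permutation′ r ] ∃[ v ] IsSimplePath v (λ i → e (π ⟨$⟩ʳ i)))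

  evenVertex : Fin (suc r) → Vertex
  evenVertex i = vertex (2 * toℕ i)

  evenArc : Fin r → Arc
  evenArc i = (vertex (2 * toℕ i) , 2)

module Submission where

-- As a and b are odd, the step 2 lies in D′, so it occurs exactly once in A and once in B, after
-- the same partial sum t, and both words have sum S = r (r + 1) / 2.  Writing r = 4 q + 1, we get
-- S = (2 q + 1) r, which is odd and a multiple of r.  The arcs of step 2 in H + 4k have the tails
-- t + j S + 4k with j < 4.  Modulo r such a tail is t + 4k and hence determines k; modulo 4 the
-- term j S reaches every class, so every tail is obtained.  The colour of 2i → 2i + 2 is thus
-- (2i - t) / 4 modulo r, which is injective in i because 2 is invertible modulo r.

open import Defs
import Algebra.Properties.CommutativeMonoid.Sum as Sum
open import Data.Fin.Base using (Fin; zero; suc; toℕ; punchOut)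
open import Data.Fin.Permutation using (permutation; _⟨$⟩ʳ_; _⟨$⟩ˡ_; inverseˡ; inverseʳ)
open import Data.Fin.Properties
  using (_≟_; 0≢1+n; any?; injective⇒≤; punchOut-injective; suc-injective;
         toℕ-fromℕ<; toℕ-inject₁; toℕ-injective; toℕ<n; toℕ≤pred[n])
open import Data.List.Base using (List; []; _∷_; _++_; concat; length; tabulate)
open import Data.List.Membership.Propositional using (_∈_; _∉_)
open import Data.List.Membership.Propositional.Properties
  using (∈-++⁺ˡ; ∈-++⁺ʳ; ∈-++⁻; ∈-map⁺; ∈-map⁻; ∈-tabulate⁻)
open import Data.List.Properties using (++-identityʳ; tabulate-cong)
open import Data.List.Relation.Unary.All using (All; []; _∷_)
open import Data.List.Relation.Unary.Any using (here; there)
open import Data.Nat.Base hiding (_/_; _%_)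
open import Data.Nat.DivMod
  using (_%_; _/_; _mod_; m≡m%n+[m/n]*n; [m+kn]%n≡m%n; m%n<n; m%n%n≡m%n; m<n⇒m%n≡m)
open import Data.Nat.ListAction using (sum)
open import Data.Nat.Properties as ℕ
  using (+-0-commutativeMonoid; +-assoc; +-cancelʳ-≡; +-comm; +-identityʳ; +-suc; *-cancelˡ-≡;
         *-monoʳ-≤; *-monoˡ-<; m*n≢0; 1+n≰n; <-≤-trans; ≤-<-trans; ≤-trans)
open import Data.Nat.Tactic.RingSolver using (solve-∀)
open import Data.Product.Base using (∃-syntax; ∃₂; _×_; _,_; proj₁; proj₂)
open import Data.Sum.Base using (inj₁; inj₂)
open import Function.Base using (_∘_)
open import Function.Definitions using (Injective)
open import Relation.Binary.PropositionalEquality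
open import Relation.Nullary using (yes; no; contradiction)

private module ∑ = Sum +-0-commutativeMonoid

-- Injections of a finite set and rearrangement of sums.

-- Pigeonhole: if y were missed, punching it out of the codomain would inject `Fin (suc n)` into
-- `Fin n`.
injective⇒surjective : ∀ {n} {f : Fin n → Fin n} → Injective _≡_ _≡_ f → ∀ y → ∃[ x ] f x ≡ y
injective⇒surjective {suc n} {f} f-inj y with any? (λ x → f x ≟ y)
... | yes x-fx≡y = x-fx≡y
... | no  ∄x     = contradiction (injective⇒≤ {f = λ x → punchOut (y≢f x)}
                     (λ {x} {x′} eq → f-inj (punchOut-injective (y≢f x) (y≢f x′) eq))) 1+n≰n
  where
  y≢f : ∀ x → y ≢ f x
  y≢f x y≡fx = ∄x (x , sym y≡fx)

injective⇒permutation : ∀ {n} (f : Fin n → Fin n) → Injective _≡_ _≡_ f →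
                        ∃[ π ] (∀ i → π ⟨$⟩ʳ i ≡ f i)
injective⇒permutation f f-inj =
  permutation f (proj₁ ∘ f-sur) (proj₂ ∘ f-sur) (λ x → f-inj (proj₂ (f-sur (f x)))) , λ _ → refl
  where
  f-sur = injective⇒surjective f-inj

sum-tabulate : ∀ {n} (f : Fin n → ℕ) → sum (tabulate f) ≡ ∑.sum f
sum-tabulate {zero}  f = refl
sum-tabulate {suc n} f = cong (f zero +_) (sum-tabulate (f ∘ suc))

-- Choosing for each j a preimage under f of h j gives an injection, since h is injective, hence a
-- permutation; it rearranges the sum of f into that of h.
sum-tabulate-onto : ∀ {n} (f h : Fin n → ℕ) → Injective _≡_ _≡_ h → (∀ j → ∃[ i ] f i ≡ h j) →
                    sum (tabulate f) ≡ sum (tabulate h)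
sum-tabulate-onto f h h-inj onto = begin
  sum (tabulate f)            ≡⟨ sum-tabulate f ⟩
  ∑.sum f                     ≡⟨ ∑.sum-permute f (proj₁ perm) ⟩
  ∑.sum (f ∘ (proj₁ ∘ onto))  ≡⟨ ∑.sum-cong-≗ (proj₂ ∘ onto) ⟩
  ∑.sum h                     ≡⟨ sum-tabulate h ⟨
  sum (tabulate h)            ∎
  where
  open ≡-Reasoning
  perm = injective⇒permutation (proj₁ ∘ onto) λ {j} {j′} eq →
    h-inj (trans (sym (proj₂ (onto j))) (trans (cong f eq) (proj₂ (onto j′))))

-- Doubling and adding n avoid both division and subtraction. The start k is arbitrary because
-- removing the first term turns it into k + 1.
sum-interval : ∀ n k → 2 * sum (tabulate {n = n} (λ i → k + toℕ i)) + n ≡ n * (2 * k + n)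
sum-interval zero    k = refl
sum-interval (suc n) k = begin
  2 * (k + 0 + sum (tabulate {n = n} (λ i → k + suc (toℕ i)))) + suc n
    ≡⟨ cong (λ w → 2 * (k + 0 + sum w) + suc n) (tabulate-cong {n = n} (λ i → +-suc k (toℕ i))) ⟩
  2 * (k + 0 + σ) + suc n            ≡⟨ regroup k σ n ⟩
  (2 * σ + n) + suc (2 * k)          ≡⟨ cong (_+ suc (2 * k)) (sum-interval n (suc k)) ⟩
  n * (2 * suc k + n) + suc (2 * k)  ≡⟨ expand n k ⟩
  suc n * (2 * k + suc n)            ∎
  where
  open ≡-Reasoning
  σ = sum (tabulate {n = n} (λ i → suc k + toℕ i))
  regroup : ∀ k σ n → 2 * (k + 0 + σ) + suc n ≡ (2 * σ + n) + suc (2 * k)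
  regroup = solve-∀
  expand : ∀ n k → n * (2 * suc k + n) + suc (2 * k) ≡ suc n * (2 * k + suc n)
  expand = solve-∀

-- Words in which a letter occurs exactly once.

-- The prefix is kept as data because its sum is the offset of the tail of the arc with step s.
record OccursOnce {A : Set} (s : A) (w : List A) : Set where
  field
    before after : List A
    split        : w ≡ before ++ s ∷ after
    ∉before      : s ∉ before
    ∉after       : s ∉ after

once-∷ : ∀ {A : Set} {s x : A} {w} → s ≢ x → OccursOnce s w → OccursOnce s (x ∷ w)
once-∷ {x = x} s≢x once = record
  { before  = x ∷ before
  ; after   = after
  ; split   = cong (x ∷_) split
  ; ∉before = λ { (here s≡x) → s≢x s≡x ; (there s∈) → ∉before s∈ }
  ; ∉after  = ∉after
  }
  where open OccursOnce once

tabulate-once : ∀ {A : Set} {n} (f : Fin n → A) i → (∀ j → f j ≡ f i → j ≡ i) →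
                OccursOnce (f i) (tabulate f)
tabulate-once f zero unique = record
  { before  = []
  ; after   = tabulate (f ∘ suc)
  ; split   = refl
  ; ∉before = λ ()
  ; ∉after  = λ f0∈ → let j , f0≡ = ∈-tabulate⁻ f0∈ in 0≢1+n (sym (unique (suc j) (sym f0≡)))
  }
tabulate-once f (suc i) unique = once-∷ (λ eq → 0≢1+n (unique zero (sym eq)))
  (tabulate-once (f ∘ suc) i (λ j eq → suc-injective (unique (suc j) eq)))

-- Congruences between natural numbers.

infix 4 _≋_[mod_]

-- Stated with multiples of the modulus on both sides, so that no subtraction occurs.
_≋_[mod_] : ℕ → ℕ → ℕ → Set
m ≋ n [mod d ] = ∃₂ λ x y → m + x * d ≡ n + y * d

module _ {d : ℕ} where

  ≋-refl : ∀ {m} → m ≋ m [mod d ]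
  ≋-refl = 0 , 0 , refl

  ≋-sym : ∀ {m n} → m ≋ n [mod d ] → n ≋ m [mod d ]
  ≋-sym (x , y , eq) = y , x , sym eq

  ≋-trans : ∀ {l m n} → l ≋ m [mod d ] → m ≋ n [mod d ] → l ≋ n [mod d ]
  ≋-trans {l} {m} {n} (x , y , eq) (x′ , y′ , eq′) = x + x′ , y + y′ , (begin
    l + (x + x′) * d      ≡⟨ regroup l x x′ d ⟩
    (l + x * d) + x′ * d  ≡⟨ cong (_+ x′ * d) eq ⟩
    (m + y * d) + x′ * d  ≡⟨ swap m y x′ d ⟩
    (m + x′ * d) + y * d  ≡⟨ cong (_+ y * d) eq′ ⟩
    (n + y′ * d) + y * d  ≡⟨ swap n y′ y d ⟩
    (n + y * d) + y′ * d  ≡⟨ regroup n y y′ d ⟨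
    n + (y + y′) * d      ∎)
    where
    open ≡-Reasoning
    regroup : ∀ l x x′ d → l + (x + x′) * d ≡ (l + x * d) + x′ * d
    regroup = solve-∀
    swap : ∀ m y x′ d → (m + y * d) + x′ * d ≡ (m + x′ * d) + y * d
    swap = solve-∀

  ≋-+ : ∀ {m n m′ n′} → m ≋ n [mod d ] → m′ ≋ n′ [mod d ] → m + m′ ≋ n + n′ [mod d ]
  ≋-+ {m} {n} {m′} {n′} (x , y , eq) (x′ , y′ , eq′) = x + x′ , y + y′ ,
    trans (interchange m m′ x x′ d) (trans (cong₂ _+_ eq eq′) (sym (interchange n n′ y y′ d)))
    where
    interchange : ∀ m m′ x x′ d → m + m′ + (x + x′) * d ≡ (m + x * d) + (m′ + x′ * d)
    interchange = solve-∀

  ≋-* : ∀ c {m n} → m ≋ n [mod d ] → c * m ≋ c * n [mod d ]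
  ≋-* c {m} {n} (x , y , eq) = c * x , c * y ,
    trans (factor c m x d) (trans (cong (c *_) eq) (sym (factor c n y d)))
    where
    factor : ∀ c m x d → c * m + c * x * d ≡ c * (m + x * d)
    factor = solve-∀

  module _ .{{_ : NonZero d}} where

    %≡⇒≋ : ∀ {m n} → m % d ≡ n % d → m ≋ n [mod d ]
    %≡⇒≋ {m} {n} eq = n / d , m / d , (begin
      m + n / d * d                  ≡⟨ cong (_+ n / d * d) (m≡m%n+[m/n]*n m d) ⟩
      m % d + m / d * d + n / d * d  ≡⟨ cong (λ z → z + m / d * d + n / d * d) eq ⟩
      n % d + m / d * d + n / d * d  ≡⟨ swap (n % d) (m / d * d) (n / d * d) ⟩
      n % d + n / d * d + m / d * d  ≡⟨ cong (_+ m / d * d) (m≡m%n+[m/n]*n n d) ⟨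
      n + m / d * d                  ∎)
      where
      open ≡-Reasoning
      swap : ∀ x y z → x + y + z ≡ x + z + y
      swap = solve-∀

    ≋⇒%≡ : ∀ {m n} → m ≋ n [mod d ] → m % d ≡ n % d
    ≋⇒%≡ {m} {n} (x , y , eq) =
      trans (sym ([m+kn]%n≡m%n m x d)) (trans (cong (_% d) eq) ([m+kn]%n≡m%n n y d))

    %-≋ : ∀ m → m % d ≋ m [mod d ]
    %-≋ m = %≡⇒≋ (m%n%n≡m%n m d)

    toℕ-mod : ∀ m → toℕ (m mod d) ≡ m % d
    toℕ-mod m = toℕ-fromℕ< (m%n<n m d)

    toℕ-mod-≋ : ∀ m → toℕ (m mod d) ≋ m [mod d ]
    toℕ-mod-≋ m = subst (_≋ m [mod d ]) (sym (toℕ-mod m)) (%-≋ m)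

    mod-cong : ∀ {m n} → m ≋ n [mod d ] → m mod d ≡ n mod d
    mod-cong {m} {n} eq = toℕ-injective (trans (toℕ-mod m) (trans (≋⇒%≡ eq) (sym (toℕ-mod n))))

    mod-injective : ∀ {m n} → m mod d ≡ n mod d → m ≋ n [mod d ]
    mod-injective {m} {n} eq = %≡⇒≋ (trans (sym (toℕ-mod m)) (trans (cong toℕ eq) (toℕ-mod n)))

  ≋⇒≡ : ∀ {m n} → m < d → n < d → m ≋ n [mod d ] → m ≡ n
  ≋⇒≡ m<d n<d eq = trans (sym (m<n⇒m%n≡m m<d)) (trans (≋⇒%≡ eq) (m<n⇒m%n≡m n<d))
    where instance _ = >-nonZero (≤-<-trans z≤n m<d)

-- Arithmetic modulo 4, r and 4 r for r = 4 q + 1.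

≋-divisor : ∀ c {d m n} → m ≋ n [mod c * d ] → m ≋ n [mod d ]
≋-divisor c {d} {m} {n} (x , y , eq) =
  x * c , y * c , trans (assoc m x c d) (trans eq (sym (assoc n y c d)))
  where
  assoc : ∀ m x c d → m + x * c * d ≡ m + x * (c * d)
  assoc = solve-∀

-- By r - 4 q = 1.
≋-crt : ∀ q {r m n} → r ≡ 1 + 4 * q → m ≋ n [mod 4 ] → m ≋ n [mod r ] → m ≋ n [mod 4 * r ]
≋-crt q {r} {m} {n} refl (x , y , eq) (x′ , y′ , eq′) =
  x + q * y′ , y + q * x′ , +-cancelʳ-≡ (4 * q * (m + n)) _ _ (begin
    m + (x + q * y′) * (4 * r) + 4 * q * (m + n)    ≡⟨ regroup q m n x y′ ⟩
    r * (m + x * 4) + 4 * q * (n + y′ * r)          ≡⟨ cong₂ (λ z z′ → r * z + 4 * q * z′) eq (sym eq′) ⟩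
    r * (n + y * 4) + 4 * q * (m + x′ * r)          ≡⟨ regroup q n m y x′ ⟨
    n + (y + q * x′) * (4 * r) + 4 * q * (n + m)
      ≡⟨ cong (λ z → n + (y + q * x′) * (4 * r) + 4 * q * z) (+-comm n m) ⟩
    n + (y + q * x′) * (4 * r) + 4 * q * (m + n)    ∎)
  where
  open ≡-Reasoning
  regroup : ∀ q m n x y′ → m + (x + q * y′) * (4 * (1 + 4 * q)) + 4 * q * (m + n)
                         ≡ (1 + 4 * q) * (m + x * 4) + 4 * q * (n + y′ * (1 + 4 * q))
  regroup = solve-∀

-- The solution k of t + 4 k ≡ x modulo r = 4 q + 1, where 4⁻¹ = 3 q + 1 and - t = 4 q t.
colour : ℕ → ℕ → ℕ → ℕ
colour q t x = (3 * q + 1) * (x + 4 * q * t)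

-- The sum r (r + 1) / 2 of 1, ..., r, as a polynomial in q with the factor r visible.
blockSum : ℕ → ℕ
blockSum q = (2 * q + 1) * (1 + 4 * q)

-- Here t + 4 q t = r t, the block term is a multiple of r, and (3 q + 1) 4 = 3 r + 1; the witness
-- collects the three resulting multiples of r.
colour-unique : ∀ q t {r} j k → r ≡ 1 + 4 * q → colour q t (t + blockSum q * j + 4 * k) ≋ k [mod r ]
colour-unique q t j k refl =
  0 , (3 * q + 1) * ((2 * q + 1) * j + t) + 3 * k , identity q t j k
  where
  identity : ∀ q t j k →
    (3 * q + 1) * (t + (2 * q + 1) * (1 + 4 * q) * j + 4 * k + 4 * q * t) + 0
    ≡ k + ((3 * q + 1) * ((2 * q + 1) * j + t) + 3 * k) * (1 + 4 * q)
  identity = solve-∀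

-- Again from 4 (3 q + 1) = 3 r + 1 and t + 4 q t = r t. It holds for every j, which leaves j free
-- to be chosen modulo 4.
colour-solves : ∀ q t {r} j x → r ≡ 1 + 4 * q → t + blockSum q * j + 4 * colour q t x ≋ x [mod r ]
colour-solves q t j x refl =
  0 , t + (2 * q + 1) * j + 3 * (x + 4 * q * t) , identity q t j x
  where
  identity : ∀ q t j x →
    t + (2 * q + 1) * (1 + 4 * q) * j + 4 * ((3 * q + 1) * (x + 4 * q * t)) + 0
    ≡ x + (t + (2 * q + 1) * j + 3 * (x + 4 * q * t)) * (1 + 4 * q)
  identity = solve-∀

colour-cong : ∀ q t {r x y} → x ≋ y [mod r ] → colour q t x ≋ colour q t y [mod r ]
colour-cong q t eq = ≋-* (3 * q + 1) (≋-+ eq ≋-refl)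

-- By `colour-solves` with j = 0, the colour determines x modulo r.
colour-injective : ∀ q t {r x y} → r ≡ 1 + 4 * q → colour q t x ≋ colour q t y [mod r ] → x ≋ y [mod r ]
colour-injective q t {x = x} {y} r≡1+4q eq = ≋-trans (≋-sym (colour-solves q t 0 x r≡1+4q))
  (≋-trans (≋-+ (≋-refl {m = t + blockSum q * 0}) (≋-* 4 eq)) (colour-solves q t 0 y r≡1+4q))

-- The inverse of 2 is 2 q + 1, since 2 (2 q + 1) = r + 1.
halve : ∀ q {r x y} → r ≡ 1 + 4 * q → 2 * x ≋ 2 * y [mod r ] → x ≋ y [mod r ]
halve q {x = x} {y} refl eq = ≋-trans (≋-sym (inverse x)) (≋-trans (≋-* (2 * q + 1) eq) (inverse y))
  where
  inverse : ∀ x → (2 * q + 1) * (2 * x) ≋ x [mod 1 + 4 * q ]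
  inverse x = 0 , x , identity q x
    where
    identity : ∀ q x → (2 * q + 1) * (2 * x) + 0 ≡ x + x * (1 + 4 * q)
    identity = solve-∀

-- The block sum is odd, hence its own inverse modulo 4, and - t = 3 t.  The polynomial in the
-- witness is (blockSum q ² - 1) / 4.
block-solves : ∀ q t x k → t + blockSum q * (blockSum q * (x + 3 * t)) + 4 * k ≋ x [mod 4 ]
block-solves q t x k =
  0 , t + (16 * (q * q * q * q) + 24 * (q * q * q) + 13 * (q * q) + 3 * q) * (x + 3 * t) + k ,
  identity q t x k
  where
  identity : ∀ q t x k →
    t + (2 * q + 1) * (1 + 4 * q) * ((2 * q + 1) * (1 + 4 * q) * (x + 3 * t)) + 4 * k + 0
    ≡ x + (t + (16 * (q * q * q * q) + 24 * (q * q * q) + 13 * (q * q) + 3 * q) * (x + 3 * t) + k) * 4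
  identity = solve-∀

-- Walks along concatenated words.

module _ (r : ℕ) .{{_ : NonTrivial r}} where

  private instance
    r≢0 : NonZero r
    r≢0 = nonTrivial⇒nonZero r

    4r≢0 : NonZero (4 * r)
    4r≢0 = m*n≢0 4 r

  vertex-⊕ : ∀ m n → vertex r m ⊕ n ≡ vertex r (m + n)
  vertex-⊕ m n = mod-cong {{4r≢0}} (≋-+ (toℕ-mod-≋ m) ≋-refl)

  -- Start vertices have the form `vertex r m` with m unreduced, so that the offsets of successive
  -- pieces add up as natural numbers.
  walk-++ : ∀ m u w →
            walk r (vertex r m) (u ++ w) ≡ walk r (vertex r m) u ++ walk r (vertex r (m + sum u)) w
  walk-++ m []      w = cong (λ z → walk r (vertex r z) w) (sym (+-identityʳ m))
  walk-++ m (s ∷ u) w = cong ((vertex r m , s) ∷_) (begin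
    walk r (vertex r m ⊕ s) (u ++ w)
      ≡⟨ cong (λ x → walk r x (u ++ w)) (vertex-⊕ m s) ⟩
    walk r (vertex r (m + s)) (u ++ w)
      ≡⟨ walk-++ (m + s) u w ⟩
    walk r (vertex r (m + s)) u ++ walk r (vertex r (m + s + sum u)) w
      ≡⟨ cong₂ (λ x z → walk r x u ++ walk r (vertex r z) w) (sym (vertex-⊕ m s)) (+-assoc m s (sum u)) ⟩
    walk r (vertex r m ⊕ s) u ++ walk r (vertex r (m + (s + sum u))) w  ∎)
    where open ≡-Reasoning

  walk-step : ∀ {x y s} w → (y , s) ∈ walk r x w → s ∈ w
  walk-step (s ∷ w) (here refl) = here refl
  walk-step (s ∷ w) (there e∈)  = there (walk-step w e∈)

  module _ {s : ℕ} where

    walk-split⁺ : ∀ m u w → (vertex r (m + sum u) , s) ∈ walk r (vertex r m) (u ++ s ∷ w)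
    walk-split⁺ m u w =
      subst (_ ∈_) (sym (walk-++ m u (s ∷ w))) (∈-++⁺ʳ (walk r (vertex r m) u) (here refl))

    walk-split⁻ : ∀ {y} m u w → s ∉ u → s ∉ w →
                  (y , s) ∈ walk r (vertex r m) (u ++ s ∷ w) → y ≡ vertex r (m + sum u)
    walk-split⁻ m u w ∉u ∉w e∈
      with ∈-++⁻ (walk r (vertex r m) u) (subst ((_ , s) ∈_) (walk-++ m u (s ∷ w)) e∈)
    ... | inj₁ e∈u         = contradiction (walk-step u e∈u) ∉u
    ... | inj₂ (here refl) = refl
    ... | inj₂ (there e∈w) = contradiction (walk-step w e∈w) ∉w

    module _ (t S : ℕ) where

      -- Abstracts what `A` and `B` share. Along a concatenation of such words the arcs of step s
      -- have tails at offsets t, t + S, t + 2 S, and so on.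
      record Block (w : List ℕ) : Set where
        field
          once       : OccursOnce s w
          sum-before : sum (OccursOnce.before once) ≡ t
          sum-word   : sum w ≡ S
        open OccursOnce once public

      private
        first : ∀ m → m + t ≡ m + (t + S * 0)
        first m = identity m t S
          where
          identity : ∀ m t S → m + t ≡ m + (t + S * 0)
          identity = solve-∀

        next : ∀ m j → m + S + (t + S * j) ≡ m + (t + S * suc j)
        next m j = identity m t S j
          where
          identity : ∀ m t S j → m + S + (t + S * j) ≡ m + (t + S * suc j)
          identity = solve-∀

      block⁺ : ∀ {w} → Block w → ∀ m → (vertex r (m + t) , s) ∈ walk r (vertex r m) w
      block⁺ block m = subst₂ (λ z v → (vertex r (m + z) , s) ∈ walk r (vertex r m) v)
        sum-before (sym split) (walk-split⁺ m before after)
        where open Block block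

      block⁻ : ∀ {w y} → Block w → ∀ m → (y , s) ∈ walk r (vertex r m) w → y ≡ vertex r (m + t)
      block⁻ block m e∈ = trans
        (walk-split⁻ m before after ∉before ∉after (subst (λ v → _ ∈ walk r (vertex r m) v) split e∈))
        (cong (λ z → vertex r (m + z)) sum-before)
        where open Block block

      walk-block-++ : ∀ {w} → Block w → ∀ m v →
                      walk r (vertex r m) (w ++ v) ≡ walk r (vertex r m) w ++ walk r (vertex r (m + S)) v
      walk-block-++ {w} block m v = trans (walk-++ m w v)
        (cong (λ z → walk r (vertex r m) w ++ walk r (vertex r (m + z)) v) (Block.sum-word block))

      blocks⁺ : ∀ {ws} → All Block ws → ∀ m j → j < length ws →
                (vertex r (m + (t + S * j)) , s) ∈ walk r (vertex r m) (concat ws)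
      blocks⁺ {w ∷ ws} (block ∷ blocks) m zero    j< =
        subst₂ (λ z v → (vertex r z , s) ∈ v) (first m) (sym (walk-block-++ block m (concat ws)))
          (∈-++⁺ˡ (block⁺ block m))
      blocks⁺ {w ∷ ws} (block ∷ blocks) m (suc j) j< =
        subst₂ (λ z v → (vertex r z , s) ∈ v) (next m j) (sym (walk-block-++ block m (concat ws)))
          (∈-++⁺ʳ (walk r (vertex r m) w) (blocks⁺ blocks (m + S) j (s≤s⁻¹ j<)))

      -- The mere existence of j suffices for reading off colours: they are computed modulo r, where
      -- the term S j vanishes for S = `blockSum q`.
      blocks⁻ : ∀ {ws} → All Block ws → ∀ m {y} → (y , s) ∈ walk r (vertex r m) (concat ws) →
                ∃[ j ] y ≡ vertex r (m + (t + S * j))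
      blocks⁻ {w ∷ ws} (block ∷ blocks) m e∈
        with ∈-++⁻ (walk r (vertex r m) w) (subst (_ ∈_) (walk-block-++ block m (concat ws)) e∈)
      ... | inj₁ e∈w = 0 , trans (block⁻ block m e∈w) (cong (vertex r) (first m))
      ... | inj₂ e∈ws with j , eq ← blocks⁻ blocks (m + S) e∈ws =
        suc j , trans eq (cong (vertex r) (next m j))

  -- Colours of the arcs of step s.

  module _ (q t : ℕ) (r≡1+4q : r ≡ 1 + 4 * q) {s : ℕ} {ws : List (List ℕ)}
           (blocks : All (Block {s} t (blockSum q)) ws) (4≤ws : 4 ≤ length ws) where

    private
      H : List (Arc r)
      H = walk r (vertex r 0) (concat ws)

    develop-colour : ∀ x k → (vertex r x , s) ∈ develop r H k → colour q t x ≋ toℕ k [mod r ]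
    develop-colour x k e∈
      with (y , _) , y∈ , eq ← ∈-map⁻ (translate r (4 * toℕ k)) e∈
      with refl ← cong proj₂ eq
      with j , refl ← blocks⁻ t (blockSum q) blocks 0 y∈ =
      ≋-trans
        -- Equality of the tails is a congruence modulo 4 r; only its consequence modulo r enters
        -- the colour.
        (colour-cong q t (≋-divisor 4 (mod-injective (trans (cong proj₁ eq) (vertex-⊕ _ (4 * toℕ k))))))
        (colour-unique q t j (toℕ k) r≡1+4q)

    colour-develop : ∀ x → (vertex r x , s) ∈ develop r H (colour q t x mod r)
    colour-develop x = subst (_∈ develop r H k) (cong (_, s) (trans (vertex-⊕ _ _) (mod-cong x≋)))
        (∈-map⁺ (translate r (4 * toℕ k)) (blocks⁺ t (blockSum q) blocks 0 j j<))
      where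
      k = colour q t x mod r
      -- Modulo 4 the shift 4 k disappears, so j alone has to bring the tail into the class of x.
      j₀ = blockSum q * (x + 3 * t)
      -- Reduction modulo 4 preserves that class and places j among the first four blocks.
      j = j₀ % 4
      j< : j < length ws
      j< = <-≤-trans (m%n<n j₀ 4) 4≤ws
      x≋ : t + blockSum q * j + 4 * toℕ k ≋ x [mod 4 * r ]
      -- The choice of j gives the congruence modulo 4, the choice of k the one modulo r.
      x≋ = ≋-crt q r≡1+4q
        (≋-trans (≋-+ (≋-+ (≋-refl {m = t}) (≋-* (blockSum q) (%-≋ j₀))) ≋-refl)
                 (block-solves q t x (toℕ k)))
        (≋-trans (≋-+ (≋-refl {m = t + blockSum q * j}) (≋-* 4 (toℕ-mod-≋ (colour q t x))))
                 (colour-solves q t j x r≡1+4q))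

    hasColour : ∀ x → HasColour r H (vertex r x , s) (colour q t x mod r)
    hasColour x = colour-develop x , λ l e∈ → toℕ-injective (≋⇒≡ (toℕ<n l) (toℕ<n (colour q t x mod r))
      (≋-trans (≋-sym (develop-colour x l e∈)) (≋-sym (toℕ-mod-≋ (colour q t x)))))

    rainbow : Rainbow r H {r} (λ i → (vertex r (2 * toℕ i) , s))
    rainbow = (λ i → colour q t (2 * toℕ i) mod r) ,
      (λ i → hasColour (2 * toℕ i)) , λ {i} {j} eq →
      toℕ-injective (≋⇒≡ (toℕ<n i) (toℕ<n j)
        (halve q r≡1+4q (colour-injective q t r≡1+4q (mod-injective eq))))

  -- From a rainbow path to chain-compatibility.

  simplePath-cong : ∀ {n v} {e e′ : Fin n → Arc r} → (∀ i → e i ≡ e′ i) →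
                    IsSimplePath r v e → IsSimplePath r v e′
  simplePath-cong e≗e′ path = record
    { distinct = distinct
    ; arcs     = λ i → subst (IsArc r) (e≗e′ i) (arcs i)
    ; tails    = λ i → trans (cong (tail r) (sym (e≗e′ i))) (tails i)
    ; heads    = λ i → trans (cong (head r) (sym (e≗e′ i))) (heads i)
    }
    where open IsSimplePath path

  -- An injective colouring c of r arcs by r colours is a permutation. The arc selected from H + 4k
  -- is the one of colour k, and c itself is the order of traversal.
  rainbow⇒chainCompatible : ∀ {H v e} → IsSimplePath r v e → Rainbow r H e → ChainCompatible r H
  rainbow⇒chainCompatible {H} {v} {e} path (c , coloured , c-inj) =
    e ∘ (π ⟨$⟩ˡ_) ,
    (λ k → subst (λ l → e (π ⟨$⟩ˡ k) ∈ develop r H l) (c∘π⁻¹ k) (proj₁ (coloured (π ⟨$⟩ˡ k)))) ,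
    π , v , simplePath-cong (λ i → cong e (sym (inverseˡ π))) path
    where
    perm = injective⇒permutation c c-inj
    π = proj₁ perm
    c∘π⁻¹ : ∀ k → c (π ⟨$⟩ˡ k) ≡ k
    c∘π⁻¹ k = trans (sym (proj₂ perm (π ⟨$⟩ˡ k))) (inverseʳ π)

  -- All labels are at most 2 r < 4 r, so none wraps around and the r + 1 vertices stay distinct.
  evenPath : IsSimplePath r (evenVertex r) (evenArc r)
  evenPath = record
    { distinct = λ {i} {j} eq → toℕ-injective
        (*-cancelˡ-≡ (toℕ i) (toℕ j) 2 (≋⇒≡ (2i<4r i) (2i<4r j) (mod-injective eq)))
    ; arcs     = λ _ → s≤s z≤n , nonTrivial⇒n>1 r
    ; tails    = λ i → cong (λ m → vertex r (2 * m)) (sym (toℕ-inject₁ i))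
    ; heads    = λ i → trans (vertex-⊕ (2 * toℕ i) 2) (cong (vertex r) (shift (toℕ i)))
    }
    where
    2i<4r : (i : Fin (suc r)) → 2 * toℕ i < 4 * r
    2i<4r i = ≤-<-trans (*-monoʳ-≤ 2 (toℕ≤pred[n] i)) (*-monoˡ-< r {2} {4} (s≤s (s≤s (s≤s z≤n))))
    shift : ∀ m → 2 * m + 2 ≡ 2 * suc m
    shift = solve-∀

-- The words `A` and `B` of a terrace.

module _ {n : ℕ} (q : ℕ) (r≡1+4q : 3 + n ≡ 1 + 4 * q) (T : NormalizedR*Terrace (3 + n)) where

  open NormalizedR*Terrace T

  -- The differences run once through 1, ..., 4 q. Doubling and adding 2 + n = 4 q bring the
  -- equation to the form of `sum-interval`.
  sum-d : sum (tabulate d) ≡ 2 * q * (1 + 4 * q)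
  sum-d = *-cancelˡ-≡ _ _ 2 (+-cancelʳ-≡ (2 + n) _ _ (begin
    2 * sum (tabulate d) + (2 + n)
      ≡⟨ cong (λ σ → 2 * σ + (2 + n)) sum≡ ⟩
    2 * sum (tabulate {n = 2 + n} (λ i → 1 + toℕ i)) + (2 + n)
      ≡⟨ sum-interval (2 + n) 1 ⟩
    (2 + n) * (2 + (2 + n))
      ≡⟨ cong (λ m → m * (2 + m)) n+2≡4q ⟩
    4 * q * (2 + 4 * q)
      ≡⟨ identity q ⟩
    2 * (2 * q * (1 + 4 * q)) + 4 * q
      ≡⟨ cong (2 * (2 * q * (1 + 4 * q)) +_) n+2≡4q ⟨
    2 * (2 * q * (1 + 4 * q)) + (2 + n)
      ∎))
    where
    open ≡-Reasoning
    n+2≡4q : 2 + n ≡ 4 * q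
    n+2≡4q = ℕ.suc-injective r≡1+4q
    sum≡ : sum (tabulate d) ≡ sum (tabulate {n = 2 + n} (λ i → 1 + toℕ i))
    sum≡ = sum-tabulate-onto d (λ i → 1 + toℕ i) (toℕ-injective ∘ ℕ.suc-injective)
      (λ j → let i , di≡ , _ = diffs-once (1 + toℕ j) (s≤s z≤n) (toℕ<n j) in i , di≡)
    identity : ∀ q → 4 * q * (2 + 4 * q) ≡ 2 * (2 * q * (1 + 4 * q)) + 4 * q
    identity = solve-∀

  odd≢2 : ∀ {m} → m % 2 ≡ 1 → 2 ≢ m
  odd≢2 () refl

  once-D′ : OccursOnce 2 D′
  once-D′ = let i , di≡2 , unique = diffs-once 2 (s≤s z≤n) (s≤s (s≤s z≤n)) in
            locate i di≡2 (λ _ eq → sym (unique eq))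
    where
    locate : ∀ i → d i ≡ 2 → (∀ j → d j ≡ 2 → j ≡ i) → OccursOnce 2 D′
    -- With r written as 3 + n, `position 0` and `position 1` compute to `zero` and `suc zero`, so
    -- these two differences are a and b, which are odd.
    locate zero          di≡2 _      = contradiction (sym di≡2) (odd≢2 a-odd)
    locate (suc zero)    di≡2 _      = contradiction (sym di≡2) (odd≢2 b-odd)
    locate (suc (suc i)) di≡2 unique = subst (λ s → OccursOnce s D′) di≡2
      (tabulate-once (λ k → d (suc (suc k))) i
        (λ j eq → suc-injective (suc-injective (unique (suc (suc j)) (trans eq di≡2)))))

  blocks : ∃[ t ] All (Block (3 + n) {2} t (blockSum q)) (A ∷ B ∷ A ∷ B ∷ [])
  -- The offset t is fixed by `refl` in `block-A`: it is a + r + b plus the sum of the letters of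
  -- `D′` before 2.
  blocks = _ , block-A ∷ block-B ∷ block-A ∷ block-B ∷ []
    where
    once-∷∷∷ : ∀ {x y} → x % 2 ≡ 1 → y % 2 ≡ 1 → OccursOnce 2 (x ∷ 3 + n ∷ y ∷ D′)
    once-∷∷∷ x-odd y-odd = once-∷ (odd≢2 x-odd) (once-∷ (λ ()) (once-∷ (odd≢2 y-odd) once-D′))

    sum-A : sum A ≡ blockSum q
    sum-A = begin
      -- `sum (tabulate d)` unfolds to a + (b + sum D′).
      a + (3 + n + (b + sum D′))              ≡⟨ regroup a b (3 + n) (sum D′) ⟩
      3 + n + sum (tabulate d)                ≡⟨ cong₂ _+_ r≡1+4q sum-d ⟩
      1 + 4 * q + 2 * q * (1 + 4 * q)         ≡⟨ identity q ⟩
      (2 * q + 1) * (1 + 4 * q)               ∎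
      where
      open ≡-Reasoning
      regroup : ∀ a b r σ → a + (r + (b + σ)) ≡ r + (a + (b + σ))
      regroup = solve-∀
      identity : ∀ q → 1 + 4 * q + 2 * q * (1 + 4 * q) ≡ (2 * q + 1) * (1 + 4 * q)
      identity = solve-∀

    exchange : ∀ x y r σ → x + (r + (y + σ)) ≡ y + (r + (x + σ))
    exchange = solve-∀

    block-A : Block (3 + n) _ (blockSum q) A
    block-A = record { once = once-∷∷∷ a-odd b-odd ; sum-before = refl ; sum-word = sum-A }

    block-B : Block (3 + n) _ (blockSum q) B
    block-B = record
      { once       = once-∷∷∷ b-odd a-odd
      -- The letter 2 comes after a, r and b in both words, so exchanging a and b preserves the sum
      -- before it.
      ; sum-before = exchange b a (3 + n) (sum (OccursOnce.before once-D′))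
      ; sum-word   = trans (exchange b a (3 + n) (sum D′)) sum-A
      }

lemma5p4 : (r : ℕ) .{{_ : NonTrivial r}} → 9 ≤ r → r % 4 ≡ 1 →
    (T : NormalizedR*Terrace r) →
    IsSimplePath r (evenVertex r) (evenArc r) ×
    Rainbow r (starter r T) (evenArc r) ×
    ChainCompatible r (starter r T)
lemma5p4 r@(suc (suc (suc n))) (s≤s (s≤s (s≤s _))) r%4≡1 T =
  path , rainbow-2 , rainbow⇒chainCompatible r {H = starter r T} path rainbow-2
  where
  open NormalizedR*Terrace T using (A; B)

  r≡1+4q : r ≡ 1 + 4 * (r / 4)
  r≡1+4q = trans (m≡m%n+[m/n]*n r 4) (cong₂ _+_ r%4≡1 (ℕ.*-comm (r / 4) 4))

  path : IsSimplePath r (evenVertex r) (evenArc r)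
  path = evenPath r

  -- `concat` ends in an extra empty word.
  ABAB≡concat : A ++ B ++ A ++ B ≡ concat (A ∷ B ∷ A ∷ B ∷ [])
  ABAB≡concat = cong (λ v → A ++ B ++ A ++ v) (sym (++-identityʳ B))

  rainbow-2 : Rainbow r (starter r T) (evenArc r)
  rainbow-2 = subst (λ w → Rainbow r (walk r (vertex r 0) w) (evenArc r)) (sym ABAB≡concat)
    -- The bound 4 ≤ 4 is tight: the four blocks supply one j for each residue modulo 4.
    (rainbow r (r / 4) _ r≡1+4q (proj₂ (blocks (r / 4) r≡1+4q T)) ℕ.≤-refl)
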